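{- Let $\mathbb{K}$ be an associative ring with unity (not necessarily commutative). Let $P$ be any finite poset. Let $f\in\mathbb{K}^{\widehat{P}}$ be a $\mathbb{K}$-labeling of $P$ such that $Rf\neq\bot$, where $R$ is birational rowmotion of $P$. Let $a=f(0)$ and $b=f(1)$. Assume that $(Rf)(u)$ is invertible for every $u\in\widehat{P}$ with $u\gtrdot 0$. Then $$b\cdot\sum_{\substack{u\in\widehat{P};\\ u\gtrdot 0}}\big((Rf)(u)\big)^{ -1}\cdot a=\sum_{\substack{u\in\widehat{P};\\ u\lessdot 1}}f(u).$$
   Context: $\mathbb{K}$ is a fixed associative ring with unity, not necessarily commutative. An element is invertible if it has a two-sided inverse $x^{ -1}$. Extended poset. For a finite poset $P$, $\widehat{P}$ is the poset on the disjoint union $P\sqcup\{0,1\}$ in which $u\le v$ iff ($u,v\in P$ and $u\le v$ in $P$) or $u=0$ or $v=1$. Write $u\lessdot v$ (equivalently $v\gtrdot u$) if $u<v$ and no $w$ satisfies $u<w<v$ (in $\widehat{P}$). Labelings and partial maps. A $\mathbb{K}$-labeling of $P$ is a map $f:\widehat{P}\to\mathbb{K}$; the set of these is $\mathbb{K}^{\widehat{P}}$. A partial map $F:X\dashrightarrow Y$ is a map $X\to Y\sqcup\{\bot\}$, where $\bot$ means "undefined"; it is extended by $F(\bot)=\bot$, and partial maps are composed accordingly. Toggles. For $v\in P$, the toggle $T_v:\mathbb{K}^{\widehat{P}}\dashrightarrow\mathbb{K}^{\widehat{P}}$ is defined by $(T_vf)(w)=f(w)$ for $w\ne v$ and $$(T_vf)(v)=\Big(\sum_{u\in\widehat{P},\,u\lessdot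 v}f(u)\Big)\cdot f(v)^{ -1}\cdot\Big(\sum_{u\in\widehat{P},\,u\gtrdot v}f(u)^{ -1}\Big)^{ -1};$$ if any inverse in this formula does not exist, then $T_vf:=\bot$. Birational rowmotion. $R:=T_{v_1}\circ T_{v_2}\circ\cdots\circ T_{v_m}:\mathbb{K}^{\widehat{P}}\dashrightarrow\mathbb{K}^{\widehat{P}}$, where $(v_1,\ldots,v_m)$ is any linear extension of $P$ (a list of all elements of $P$, each exactly once, such that $v_i<v_j$ implies $i<j$); so the toggles at larger elements are applied first. This partial map does not depend on the choice of linear extension. -}

module Defs where

open import Algebra.Bundles using (Ring)
import Algebra.Definitions as AlgebraDefinitions
open import Data.Fin.Base as Fin using (Fin)
open import Data.List.Base using (List; []; _∷_; map; foldr; length; lookup)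
open import Data.List.Membership.Propositional using (_∈_; lose)
open import Data.List.Membership.Propositional.Properties using (∈-map⁺)
open import Data.List.Relation.Unary.Any using (here; there; any?; satisfied)
open import Data.List.Relation.Unary.Enumerates.Setoid using (IsEnumeration)
open import Data.List.Relation.Unary.Unique.Propositional using (Unique)
open import Data.Product.Base using (Σ; ∃; _×_; _,_; proj₁)
open import Data.Unit.Polymorphic.Base using (⊤)
open import Level using (Level; _⊔_; suc)
open import Relation.Binary.Core using (Rel)
open import Relation.Binary.Definitions using (Decidable; DecidableEquality)
open import Relation.Binary.Structures using (IsDecPartialOrder)
open import Relation.Binary.PropositionalEquality using (_≡_; refl; setoid)
import Relation.Binary.Construct.Add.Extrema.NonStrict as AddExtrema
import Relation.Binary.Construct.NonStrictToStrict as ToStrict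
open import Relation.Nullary.Construct.Add.Extrema using (_±; ⊥±; ⊤±; [_])
open import Relation.Nullary.Decidable using (Dec; yes; no; map′; ¬?; _×-dec_)
open import Relation.Nullary.Negation using (¬_)
import Relation.Unary as U

-- A partial map X ⇀ Y cannot be a function X → Maybe Y here, because
-- invertibility in an arbitrary ring is not decidable.  Instead, a possibly
-- undefined element of Y is a type `Defined` (inhabited exactly when the
-- element is not "undefined") together with the value it then has.

record Partial {y} (d : Level) (Y : Set y) : Set (y ⊔ suc d) where
  field
    Defined : Set d
    value   : Defined → Y

open Partial public

_⇀[_]_ : ∀ {x y} → Set x → (d : Level) → Set y → Set (x ⊔ y ⊔ suc d)
X ⇀[ d ] Y = X → Partial d Y

id⇀ : ∀ {x d} {X : Set x} → X ⇀[ d ] X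
id⇀ x .Defined = ⊤
id⇀ x .value _ = x

infixr 9 _∘⇀_

_∘⇀_ : ∀ {x y z d} {X : Set x} {Y : Set y} {Z : Set z} →
       Y ⇀[ d ] Z → X ⇀[ d ] Y → X ⇀[ d ] Z
(G ∘⇀ F) x .Defined         = Σ (Defined (F x)) λ p → Defined (G (value (F x) p))
(G ∘⇀ F) x .value   (p , q) = value (G (value (F x) p)) q

-- The order is decidable (as is any order on a finite set, classically), so
-- that one can sum over the elements covering, or covered by, a given one.

record FinitePoset (p ℓ : Level) : Set (suc (p ⊔ ℓ)) where
  infix 4 _≤_
  field
    Carrier           : Set p
    _≤_               : Rel Carrier ℓ
    isDecPartialOrder : IsDecPartialOrder _≡_ _≤_
    elements          : List Carrier
    elements-unique   : Unique elements
    elements-complete : IsEnumeration (setoid Carrier) elements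

module Extended {p ℓ} (P : FinitePoset p ℓ) where
  open FinitePoset P
  open AddExtrema _≤_ using (_≤±_; ≤±-isDecPartialOrder-≡)
  open ToStrict _≡_ _≤_ using () renaming (_<_ to _<P_)
  open ToStrict _≡_ _≤±_ using (_<_; <-decidable)

  -- ⊥± and ⊤± are the added elements 0 and 1.
  P̂ : Set p
  P̂ = Carrier ±

  infix 4 _≟_ _⋖_ _⋖?_

  _≟_ : DecidableEquality P̂
  _≟_ = IsDecPartialOrder._≟_ (≤±-isDecPartialOrder-≡ isDecPartialOrder)

  _⋖_ : Rel P̂ (p ⊔ ℓ)
  u ⋖ v = u < v × ¬ ∃ λ w → u < w × w < v

  P̂-elements : List P̂
  P̂-elements = ⊥± ∷ ⊤± ∷ map [_] elements

  P̂-complete : ∀ u → u ∈ P̂-elements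
  P̂-complete ⊥±    = here refl
  P̂-complete ⊤±    = there (here refl)
  P̂-complete [ v ] = there (there (∈-map⁺ [_] (elements-complete v)))

  _⋖?_ : Decidable _⋖_
  u ⋖? v = (u <? v) ×-dec ¬? (map′ satisfied
             (λ { (w , u<w<v) → lose (P̂-complete w) u<w<v })
             (any? (λ w → (u <? w) ×-dec (w <? v)) P̂-elements))
    where
    _<?_ : Decidable _<_
    _<?_ = <-decidable _≟_
             (IsDecPartialOrder._≤?_ (≤±-isDecPartialOrder-≡ isDecPartialOrder))

  record LinearExtension : Set (p ⊔ ℓ) where
    field
      list     : List Carrier
      unique   : Unique list
      complete : IsEnumeration (setoid Carrier) list
      monotone : ∀ (i j : Fin (length list)) →
                 lookup list i <P lookup list j → i Fin.< j

module Rowmotion {c r p ℓ} (𝕂 : Ring c r) (P : FinitePoset p ℓ) where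
  open Ring 𝕂
  open Extended P
  open AlgebraDefinitions _≈_ using () renaming (Invertible to InvertibleFor)

  Labeling : Set (c ⊔ p)
  Labeling = P̂ → Carrier

  Invertible : Carrier → Set (c ⊔ r)
  Invertible = InvertibleFor 1# _*_

  inv : ∀ {x} → Invertible x → Carrier
  inv = proj₁

  -- The sum of t u over all u in P̂ satisfying Q.  The summand may use the
  -- proof that u satisfies Q, as needed for sums of inverses.
  ∑ : ∀ {q} {Q : P̂ → Set q} → U.Decidable Q → (∀ u → Q u → Carrier) → Carrier
  ∑ {Q = Q} Q? t = foldr (λ u s → term u (Q? u) + s) 0# P̂-elements
    where
    term : ∀ u → Dec (Q u) → Carrier
    term u (yes q) = t u q
    term u (no  _) = 0#

  ∑-below : (v : P̂) → (∀ u → u ⋖ v → Carrier) → Carrier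
  ∑-below v = ∑ (λ u → u ⋖? v)

  ∑-above : (v : P̂) → (∀ u → v ⋖ u → Carrier) → Carrier
  ∑-above v = ∑ (λ u → v ⋖? u)

  -- The inverses occurring in the toggle formula.
  record Togglable (v : FinitePoset.Carrier P) (f : Labeling) :
                   Set (c ⊔ r ⊔ p ⊔ ℓ) where
    field
      at    : Invertible (f [ v ])
      above : ∀ u → [ v ] ⋖ u → Invertible (f u)
      sum   : Invertible (∑-above [ v ] λ u v⋖u → inv (above u v⋖u))

  toggle : FinitePoset.Carrier P → Labeling ⇀[ c ⊔ r ⊔ p ⊔ ℓ ] Labeling
  toggle v f .Defined = Togglable v f
  toggle v f .value d w with w ≟ [ v ]
  ... | yes _ = (∑-below [ v ] λ u _ → f u) * inv at * inv sum
    where open Togglable d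
  ... | no  _ = f w

  rowmotion : LinearExtension → Labeling ⇀[ c ⊔ r ⊔ p ⊔ ℓ ] Labeling
  rowmotion L = foldr (λ v F → toggle v ∘⇀ F) id⇀ (LinearExtension.list L)

{-# OPTIONS --safe #-}

-- Write g = Rf.  Each toggle sees the old values below v and the new values
-- above v, whence
--   g(v) · (Σ_{u⋗v} g(u)⁻¹) · f(v) = Σ_{u⋖v} f(u).
-- Every v ∈ P has a lower cover u, and g(v) is invertible: by assumption if
-- u = 0, and because T_u has inverted it otherwise.  So, with the weight
-- W(x,y) = g(y)⁻¹ · f(x) on the cover relations x ⋖ y, for every v ∈ P the
-- weights leaving v and the weights entering v have the same sum.  Hence the
-- weights leaving 0 and those entering 1 also have the same sum,
--   (Σ_{u⋗0} g(u)⁻¹) · a = b⁻¹ · Σ_{u⋖1} f(u).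

module Submission where

open import Defs
open import Algebra.Bundles using (Ring)
open import Relation.Nullary.Construct.Add.Extrema using (⊥±; ⊤±)

import Algebra.Properties.CommutativeSemigroup as CommutativeSemigroupProperties
import Algebra.Properties.Group as GroupProperties
open import Data.Empty using (⊥-elim)
open import Data.Fin.Base as Fin using (Fin)
open import Data.List.Base using (List; []; _∷_; map; foldr; length; lookup)
open import Data.List.Membership.Propositional using (_∈_)
open import Data.List.Properties using (foldr-cong)
open import Data.List.Relation.Unary.All as All using (All; []; _∷_)
open import Data.List.Relation.Unary.AllPairs as AllPairs using (AllPairs; []; _∷_)
open import Data.List.Relation.Unary.Any using (here; there; index)
open import Data.List.Relation.Unary.Any.Properties using (lookup-index)
import Data.Nat.Base as ℕ
open import Data.Product.Base using (∃; _×_; _,_; proj₁; proj₂)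
open import Function.Base using (_∘_)
open import Level using (_⊔_)
open import Relation.Binary.Core using (Rel)
open import Relation.Binary.Structures using (IsDecPartialOrder)
open import Relation.Binary.PropositionalEquality as ≡ using (_≡_; _≢_; refl; cong; subst)
import Relation.Binary.Construct.Add.Extrema.NonStrict as AddExtrema
import Relation.Binary.Construct.NonStrictToStrict as ToStrict
import Relation.Binary.Reasoning.Setoid as SetoidReasoning
open import Relation.Nullary.Construct.Add.Extrema using ([_])
open import Relation.Nullary.Decidable using (Dec; yes; no; _×-dec_)
open import Relation.Nullary.Negation using (¬_)
import Relation.Unary as U

-- Covers in the extended poset, and linear extensions as pairwise conditions.

module Covers {p ℓ} (P : FinitePoset p ℓ) where
  open FinitePoset P
  open Extended P
  open AddExtrema _≤_
    using (_≤±_; ⊥±≤_; _≤⊤±; [≤]-injective; ≤±-isDecPartialOrder-≡)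
  open ToStrict _≡_ _≤±_ using (_<_; <-decidable)
  open ToStrict _≡_ _≤_ using () renaming (_<_ to _<P_)

  private
    module ≤± = IsDecPartialOrder (≤±-isDecPartialOrder-≡ isDecPartialOrder)

  []<[]⇒<P : ∀ {x y} → [ x ] < [ y ] → x <P y
  []<[]⇒<P (x≤y , x≢y) = [≤]-injective x≤y , x≢y ∘ cong [_]

  ⊥±-lowest : ∀ {u} → ¬ (u ⋖ ⊥±)
  ⊥±-lowest {u} ((u≤⊥ , u≢⊥) , _) = u≢⊥ (≤±.antisym u≤⊥ (⊥±≤ u))

  ⊤±-highest : ∀ {u} → ¬ (⊤± ⋖ u)
  ⊤±-highest {u} ((⊤≤u , ⊤≢u) , _) = ⊤≢u (≤±.antisym ⊤≤u (u ≤⊤±))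

  -- One pass over the list suffices: the candidate `u` is replaced by any `w` strictly between it
  -- and `v`, so it only moves up, and an entry already passed can never come to lie strictly
  -- between the candidate and `v`. With the list of all elements of `P̂` the result is a cover.
  maximal-below : ∀ {v} (ws : List P̂) u → u < v →
    ∃ λ u′ → u ≤± u′ × u′ < v × All (λ w → ¬ (u′ < w × w < v)) ws
  maximal-below []       u u<v = u , ≤±.refl , u<v , []
  maximal-below (w ∷ ws) u u<v
    with <-decidable _≟_ ≤±._≤?_ u w ×-dec <-decidable _≟_ ≤±._≤?_ w _
  ... | yes (u<w , w<v) =
    let u′ , w≤u′ , u′<v , none = maximal-below ws w w<v
    in u′ , ≤±.trans (proj₁ u<w) w≤u′ , u′<v ,
       (λ (u′<w , _) → proj₂ u′<w (≤±.antisym (proj₁ u′<w) w≤u′)) ∷ none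
  ... | no ¬u<w<v =
    let u′ , u≤u′ , u′<v , none = maximal-below ws u u<v
    in u′ , u≤u′ , u′<v ,
       (λ (u′<w , w<v) → ¬u<w<v (≤-<-trans u≤u′ u′<w , w<v)) ∷ none
    where
    ≤-<-trans : ∀ {x y z} → x ≤± y → y < z → x < z
    ≤-<-trans x≤y (y≤z , y≢z) =
      ≤±.trans x≤y y≤z , λ { refl → y≢z (≤±.antisym y≤z x≤y) }

  lower-cover : ∀ v → v ≢ ⊥± → ∃ λ u → u ⋖ v
  lower-cover v v≢⊥ with maximal-below P̂-elements ⊥± (⊥±≤ v , v≢⊥ ∘ ≡.sym)
  ... | u , _ , u<v , none = u , u<v , λ (w , u<w<v) → All.lookup none (P̂-complete w) u<w<v

  -- The relation between an entry `x` and a later entry `y` of a linear extension. It contains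
  -- exactly what keeps the toggle at `y`, applied earlier, away from `x` and from the elements
  -- below `x`, and the toggle at `x` away from `y` and from the elements above `y`.
  Precedes : Rel Carrier _
  Precedes x y = x ≢ y × ¬ ([ y ] < [ x ])

  monotone⇒Precedes : ∀ xs →
    (∀ (i j : Fin (length xs)) → lookup xs i <P lookup xs j → i Fin.< j) →
    AllPairs (λ x y → ¬ ([ y ] < [ x ])) xs
  monotone⇒Precedes []       mono = []
  monotone⇒Precedes (x ∷ xs) mono =
    All.tabulate (λ y∈xs → subst (λ y → ¬ ([ y ] < [ x ])) (≡.sym (lookup-index y∈xs))
                                 (not-before (index y∈xs))) ∷
    monotone⇒Precedes xs (λ i j → ℕ.s<s⁻¹ ∘ mono (Fin.suc i) (Fin.suc j))
    where
    not-before : ∀ i → ¬ ([ lookup xs i ] < [ x ])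
    -- Monotonicity would place a successor index before index zero.
    not-before i y<x with () ← mono (Fin.suc i) Fin.zero ([]<[]⇒<P y<x)

  linear-Precedes : (L : LinearExtension) → AllPairs Precedes (LinearExtension.list L)
  linear-Precedes L = AllPairs.zip (unique , monotone⇒Precedes list monotone)
    where open LinearExtension L

-- Finite sums in a noncommutative ring.

module RingSums {c r} (𝕂 : Ring c r) where
  open Ring 𝕂 renaming (refl to ≈-refl)
  open CommutativeSemigroupProperties +-commutativeSemigroup using (interchange)

  sum : ∀ {a} {A : Set a} → (A → Carrier) → List A → Carrier
  sum F = foldr (λ u s → F u + s) 0#

  sum-cong : ∀ {a} {A : Set a} {F G : A → Carrier} → (∀ u → F u ≈ G u) →
             ∀ us → sum F us ≈ sum G us
  sum-cong F≈G []       = ≈-refl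
  sum-cong F≈G (u ∷ us) = +-cong (F≈G u) (sum-cong F≈G us)

  sum-map : ∀ {a b} {A : Set a} {B : Set b} (F : B → Carrier) (h : A → B) us →
            sum F (map h us) ≈ sum (F ∘ h) us
  sum-map F h []       = ≈-refl
  sum-map F h (u ∷ us) = +-congˡ (sum-map F h us)

  sum-zero : ∀ {a} {A : Set a} (us : List A) → sum (λ _ → 0#) us ≈ 0#
  sum-zero []       = ≈-refl
  sum-zero (u ∷ us) = trans (+-identityˡ _) (sum-zero us)

  sum-+ : ∀ {a} {A : Set a} (F G : A → Carrier) us →
          sum (λ u → F u + G u) us ≈ sum F us + sum G us
  sum-+ F G []       = sym (+-identityˡ 0#)
  sum-+ F G (u ∷ us) = trans (+-congˡ (sum-+ F G us)) (interchange _ _ _ _)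

  sum-swap : ∀ {a b} {A : Set a} {B : Set b} (W : A → B → Carrier) us vs →
             sum (λ u → sum (W u) vs) us ≈ sum (λ v → sum (λ u → W u v) us) vs
  sum-swap W []       vs = sym (sum-zero vs)
  sum-swap W (u ∷ us) vs =
    trans (+-congˡ (sum-swap W us vs)) (sym (sum-+ (W u) _ vs))

  *-distribˡ-sum : ∀ {a} {A : Set a} k (F : A → Carrier) us →
                   k * sum F us ≈ sum (λ u → k * F u) us
  *-distribˡ-sum k F []       = zeroʳ k
  *-distribˡ-sum k F (u ∷ us) = trans (distribˡ k _ _) (+-congˡ (*-distribˡ-sum k F us))

  *-distribʳ-sum : ∀ {a} {A : Set a} k (F : A → Carrier) us →
                   sum F us * k ≈ sum (λ u → F u * k) us
  *-distribʳ-sum k F []       = zeroˡ k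
  *-distribʳ-sum k F (u ∷ us) = trans (distribʳ k _ _) (+-congˡ (*-distribʳ-sum k F us))

  -- A global copy of the local summand of `∑`: extending by zero turns sums over covers into sums
  -- over all of `P̂`, whose order can be exchanged.
  select : ∀ {q} {Q : Set q} → Dec Q → (Q → Carrier) → Carrier
  select (yes q) t = t q
  select (no _)  t = 0#

  select-cong : ∀ {q} {Q : Set q} (d : Dec Q) {t t′ : Q → Carrier} →
                (∀ q → t q ≈ t′ q) → select d t ≈ select d t′
  select-cong (yes q) t≈t′ = t≈t′ q
  select-cong (no _)  t≈t′ = ≈-refl

  select-¬ : ∀ {q} {Q : Set q} (d : Dec Q) {t : Q → Carrier} → ¬ Q → select d t ≈ 0#
  select-¬ (yes q) ¬q = ⊥-elim (¬q q)
  select-¬ (no _)  ¬q = ≈-refl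

  *-select : ∀ {q} {Q : Set q} k (d : Dec Q) {t : Q → Carrier} →
             k * select d t ≈ select d (λ q → k * t q)
  *-select k (yes q) = ≈-refl
  *-select k (no _)  = zeroʳ k

  select-* : ∀ {q} {Q : Set q} k (d : Dec Q) {t : Q → Carrier} →
             select d t * k ≈ select d (λ q → t q * k)
  select-* k (yes q) = ≈-refl
  select-* k (no _)  = zeroˡ k

module Proof {c r p ℓ} (𝕂 : Ring c r) (P : FinitePoset p ℓ) where
  open Ring 𝕂 renaming (refl to ≈-refl)
  open Extended P
  open Rowmotion 𝕂 P
  open Covers P
  open RingSums 𝕂
  open GroupProperties +-group using (∙-cancelʳ)
  open SetoidReasoning setoid
  open FinitePoset P using (elements) renaming (Carrier to X)

  -- The summand of ∑ is a local function of Defs, so it can only be referred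
  -- to through unification.
  private
    ∑-summand : ∀ {q} {Q : P̂ → Set q} (Q? : U.Decidable Q) (t : ∀ u → Q u → Carrier) →
                ∃ λ F → ∑ Q? t ≡ sum F P̂-elements
    ∑-summand Q? t = _ , refl

    ∑-summand≡select : ∀ {q} {Q : P̂ → Set q} (Q? : U.Decidable Q) t u →
                       proj₁ (∑-summand Q? t) u ≡ select (Q? u) (t u)
    ∑-summand≡select Q? t u with Q? u
    ... | yes _ = refl
    ... | no  _ = refl

  -- Sums over a decidable subset of the extended poset.

  module _ {q} {Q : P̂ → Set q} (Q? : U.Decidable Q) where

    ∑≈sum : (t : ∀ u → Q u → Carrier) →
            ∑ Q? t ≈ sum (λ u → select (Q? u) (t u)) P̂-elements
    ∑≈sum t = reflexive
      (foldr-cong (λ u s → cong (_+ s) (∑-summand≡select Q? t u)) refl P̂-elements)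

    ∑-cong : {t t′ : ∀ u → Q u → Carrier} → (∀ u q → t u q ≈ t′ u q) → ∑ Q? t ≈ ∑ Q? t′
    ∑-cong {t} {t′} t≈t′ = begin
      ∑ Q? t                                        ≈⟨ ∑≈sum t ⟩
      sum (λ u → select (Q? u) (t u)) P̂-elements    ≈⟨ sum-cong (λ u → select-cong (Q? u) (t≈t′ u)) P̂-elements ⟩
      sum (λ u → select (Q? u) (t′ u)) P̂-elements   ≈⟨ ∑≈sum t′ ⟨
      ∑ Q? t′                                       ∎

    ∑-empty : (t : ∀ u → Q u → Carrier) → (∀ u → ¬ Q u) → ∑ Q? t ≈ 0#
    ∑-empty t ¬Q = begin
      ∑ Q? t                                       ≈⟨ ∑≈sum t ⟩
      sum (λ u → select (Q? u) (t u)) P̂-elements   ≈⟨ sum-cong (λ u → select-¬ (Q? u) (¬Q u)) P̂-elements ⟩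
      sum (λ _ → 0#) P̂-elements                    ≈⟨ sum-zero P̂-elements ⟩
      0#                                           ∎

    *-distribˡ-∑ : ∀ k (t : ∀ u → Q u → Carrier) → k * ∑ Q? t ≈ ∑ Q? (λ u q → k * t u q)
    *-distribˡ-∑ k t = begin
      k * ∑ Q? t                                               ≈⟨ *-congˡ (∑≈sum t) ⟩
      k * sum (λ u → select (Q? u) (t u)) P̂-elements           ≈⟨ *-distribˡ-sum k _ P̂-elements ⟩
      sum (λ u → k * select (Q? u) (t u)) P̂-elements           ≈⟨ sum-cong (λ u → *-select k (Q? u)) P̂-elements ⟩
      sum (λ u → select (Q? u) (λ q → k * t u q)) P̂-elements   ≈⟨ ∑≈sum _ ⟨
      ∑ Q? (λ u q → k * t u q)                                 ∎

    *-distribʳ-∑ : ∀ k (t : ∀ u → Q u → Carrier) → ∑ Q? t * k ≈ ∑ Q? (λ u q → t u q * k)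
    *-distribʳ-∑ k t = begin
      ∑ Q? t * k                                               ≈⟨ *-congʳ (∑≈sum t) ⟩
      sum (λ u → select (Q? u) (t u)) P̂-elements * k           ≈⟨ *-distribʳ-sum k _ P̂-elements ⟩
      sum (λ u → select (Q? u) (t u) * k) P̂-elements           ≈⟨ sum-cong (λ u → select-* k (Q? u)) P̂-elements ⟩
      sum (λ u → select (Q? u) (λ q → t u q * k)) P̂-elements   ≈⟨ ∑≈sum _ ⟨
      ∑ Q? (λ u q → t u q * k)                                 ∎

  -- Transport and cancellation of inverses.

  inv-subst : ∀ {x y} (x≡y : x ≡ y) (i : Invertible x) → inv (subst Invertible x≡y i) ≡ inv i
  inv-subst refl i = refl

  inv-cancelˡ : ∀ {x} (i : Invertible x) {y z} → x * y ≈ x * z → y ≈ z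
  inv-cancelˡ {x} (x⁻¹ , x⁻¹x≈1 , _) {y} {z} xy≈xz = begin
    y               ≈⟨ *-identityˡ y ⟨
    1# * y          ≈⟨ *-congʳ x⁻¹x≈1 ⟨
    x⁻¹ * x * y     ≈⟨ *-assoc x⁻¹ x y ⟩
    x⁻¹ * (x * y)   ≈⟨ *-congˡ xy≈xz ⟩
    x⁻¹ * (x * z)   ≈⟨ *-assoc x⁻¹ x z ⟨
    x⁻¹ * x * z     ≈⟨ *-congʳ x⁻¹x≈1 ⟩
    1# * z          ≈⟨ *-identityˡ z ⟩
    z               ∎

  x*[x⁻¹*y]≈y : ∀ {x} (i : Invertible x) y → x * (inv i * y) ≈ y
  x*[x⁻¹*y]≈y {x} (x⁻¹ , _ , xx⁻¹≈1) y = begin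
    x * (x⁻¹ * y)   ≈⟨ *-assoc x x⁻¹ y ⟨
    x * x⁻¹ * y     ≈⟨ *-congʳ xx⁻¹≈1 ⟩
    1# * y          ≈⟨ *-identityˡ y ⟩
    y               ∎

  y*x⁻¹*x≈y : ∀ {x} (i : Invertible x) y → y * inv i * x ≈ y
  y*x⁻¹*x≈y {x} (x⁻¹ , x⁻¹x≈1 , _) y = begin
    y * x⁻¹ * x     ≈⟨ *-assoc y x⁻¹ x ⟩
    y * (x⁻¹ * x)   ≈⟨ *-congˡ x⁻¹x≈1 ⟩
    y * 1#          ≈⟨ *-identityʳ y ⟩
    y               ∎

  -- The effect of one toggle and of a list of toggles.

  toggle-at : ∀ {v h} (d : Togglable v h) → let open Togglable d renaming (sum to total) in
              value (toggle v h) d [ v ] ≡ (∑-below [ v ] λ u _ → h u) * inv at * inv total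
  toggle-at {v} d with [ v ] ≟ [ v ]
  ... | yes _  = refl
  ... | no v≢v = ⊥-elim (v≢v refl)

  toggle-away : ∀ {v h w} (d : Togglable v h) → w ≢ [ v ] → value (toggle v h) d w ≡ h w
  toggle-away {v} {w = w} d w≢v with w ≟ [ v ]
  ... | yes w≡v = ⊥-elim (w≢v w≡v)
  ... | no _    = refl

  -- Rowmotion for an arbitrary list, so that induction can pass to tails. The head is the outermost
  -- factor: the toggles of the tail are applied first.
  toggles : List X → Labeling ⇀[ _ ] Labeling
  toggles = foldr (λ v F → toggle v ∘⇀ F) id⇀

  toggles-away : ∀ xs {f w} (d : Defined (toggles xs f)) → All (λ x → w ≢ [ x ]) xs →
                 value (toggles xs f) d w ≡ f w
  toggles-away []       d       []          = refl
  toggles-away (x ∷ xs) (d , t) (w≢x ∷ w∉) = ≡.trans (toggle-away t w≢x) (toggles-away xs d w∉)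

  -- The toggle formula at `v` with the inverses of `f [ v ]` and of the upper sum cleared. The
  -- inverses of the upper labels are kept as data, since they become the weights of the cover
  -- relations.
  record Transition (f g : Labeling) (v : X) : Set (c ⊔ r ⊔ p ⊔ ℓ) where
    field
      above    : ∀ u → [ v ] ⋖ u → Invertible (g u)
      relation : g [ v ] * (∑-above [ v ] λ u v⋖u → inv (above u v⋖u)) * f [ v ]
                 ≈ (∑-below [ v ] λ u _ → f u)

  -- The new labeling enters only through its values at `v` and at the covers of `v`, so later
  -- toggles elsewhere preserve the relation.
  Transition-resp : ∀ {f g h v} → g [ v ] ≡ h [ v ] → (∀ u → [ v ] ⋖ u → g u ≡ h u) →
                    Transition f g v → Transition f h v
  Transition-resp {f} {g} {h} {v} g≡h-at g≡h-above tr = record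
    { above    = λ u v⋖u → subst Invertible (g≡h-above u v⋖u) (above u v⋖u)
    ; relation = trans
        (*-congʳ (*-cong (reflexive (≡.sym g≡h-at))
          (∑-cong ([ v ] ⋖?_) λ u v⋖u → reflexive (inv-subst (g≡h-above u v⋖u) (above u v⋖u)))))
        relation
    }
    where open Transition tr

  -- Here `h` is the labeling just before `v` is toggled: at and below `v` it still agrees with `f`.
  -- Multiplying the toggle formula on the right by the upper sum and then by `f [ v ]` cancels the
  -- two inverses in turn.
  toggle-Transition : ∀ {f h v} (d : Togglable v h) → h [ v ] ≡ f [ v ] →
                      (∀ u → u ⋖ [ v ] → h u ≡ f u) → Transition f (value (toggle v h) d) v
  toggle-Transition {f} {h} {v} d h≡f-at h≡f-below = record
    { above    = λ u v⋖u → subst Invertible (g≡h u v⋖u) (above u v⋖u)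
    ; relation = begin
        g [ v ] * (∑-above [ v ] λ u v⋖u → inv (subst Invertible (g≡h u v⋖u) (above u v⋖u))) * f [ v ]
          ≈⟨ *-congʳ (*-cong (reflexive (toggle-at d))
               (∑-cong ([ v ] ⋖?_) λ u v⋖u → reflexive (inv-subst (g≡h u v⋖u) (above u v⋖u)))) ⟩
        (∑-below [ v ] λ u _ → h u) * inv at * inv total * (∑-above [ v ] λ u v⋖u → inv (above u v⋖u)) * f [ v ]
          ≈⟨ *-cong (y*x⁻¹*x≈y total _) (reflexive (≡.sym h≡f-at)) ⟩
        (∑-below [ v ] λ u _ → h u) * inv at * h [ v ]
          ≈⟨ y*x⁻¹*x≈y at _ ⟩
        (∑-below [ v ] λ u _ → h u)
          ≈⟨ ∑-cong (_⋖? [ v ]) (λ u u⋖v → reflexive (h≡f-below u u⋖v)) ⟩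
        (∑-below [ v ] λ u _ → f u) ∎
    }
    where
    open Togglable d renaming (sum to total)
    g = value (toggle v h) d
    g≡h : ∀ u → [ v ] ⋖ u → h u ≡ g u
    g≡h u ((_ , v≢u) , _) = ≡.sym (toggle-away d (v≢u ∘ ≡.sym))

  toggles-Transition : ∀ {xs f v} → AllPairs Precedes xs → (d : Defined (toggles xs f)) →
                       v ∈ xs → Transition f (value (toggles xs f) d) v
  -- The toggle at `x` comes last; the tail contains neither `x` nor anything below it, so those
  -- labels are still the original ones.
  toggles-Transition {x ∷ xs} (x≺ ∷ _) (d , t) (here refl) =
    toggle-Transition t
      (toggles-away xs d (All.map (λ (x≢y , _) → λ { refl → x≢y refl }) x≺))
      (λ u u⋖x → toggles-away xs d
        (All.map (λ (_ , y≮x) → λ { refl → y≮x (proj₁ u⋖x) }) x≺))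
  -- The final toggle at `x` misses `v` and its covers, because `x` differs from `v` and does not
  -- lie above it.
  toggles-Transition {x ∷ xs} (x≺ ∷ sorted) (d , t) (there v∈xs) =
    Transition-resp
      (≡.sym (toggle-away t (λ { refl → proj₁ (All.lookup x≺ v∈xs) refl })))
      (λ u v⋖u → ≡.sym (toggle-away t (λ { refl → proj₂ (All.lookup x≺ v∈xs) (proj₁ v⋖u) })))
      (toggles-Transition sorted d v∈xs)

  -- Conservation of flow along the cover relations.

  boundary-flow : ∀ (f g : Labeling) → (∀ v → Transition f g v) → g ⊤± ≡ f ⊤± →
    (g-inv : ∀ u → ⊥± ⋖ u → Invertible (g u)) →
    f ⊤± * (∑-above ⊥± λ u 0⋖u → inv (g-inv u 0⋖u)) * f ⊥± ≈ (∑-below ⊤± λ u _ → f u)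
  boundary-flow f g tr g⊤≡f⊤ g-inv = begin
    f ⊤± * (∑-above ⊥± λ u 0⋖u → inv (g-inv u 0⋖u)) * f ⊥±   ≈⟨ *-assoc _ _ _ ⟩
    f ⊤± * ((∑-above ⊥± λ u 0⋖u → inv (g-inv u 0⋖u)) * f ⊥±) ≈⟨ *-congˡ (*-distribʳ-∑ (⊥± ⋖?_) _ _) ⟩
    -- Reading `b` as `g ⊤±` lets it cancel the inverse that stands on the left of every weight
    -- entering 1.
    f ⊤± * outflow ⊥±                                        ≈⟨ *-cong (reflexive (≡.sym g⊤≡f⊤)) outflow⊥≈inflow⊤ ⟩
    g ⊤± * inflow ⊤±                                         ≈⟨ g*inflow ⊤± ⟩
    (∑-below ⊤± λ u _ → f u)                                 ∎
    where
    -- The inverse is chosen by the lower end `x`, so that `outflow` uses literally the inverses of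
    -- the hypothesis at 0 and of the `Transition` at each `v`. Witnesses for one `y` may vary with
    -- `x`; `g*inflow` cancels each term with its own.
    cover-inv : ∀ x y → x ⋖ y → Invertible (g y)
    cover-inv ⊥±    y x⋖y = g-inv y x⋖y
    cover-inv [ v ] y x⋖y = Transition.above (tr v) y x⋖y
    cover-inv ⊤±    y x⋖y = ⊥-elim (⊤±-highest x⋖y)

    weight : ∀ x y → x ⋖ y → Carrier
    weight x y x⋖y = inv (cover-inv x y x⋖y) * f x

    outflow inflow : P̂ → Carrier
    outflow x = ∑-above x (λ y → weight x y)
    inflow  y = ∑-below y (λ x → weight x y)

    g*inflow : ∀ y → g y * inflow y ≈ (∑-below y λ u _ → f u)
    g*inflow y = trans (*-distribˡ-∑ (_⋖? y) _ _)
      (∑-cong (_⋖? y) λ x x⋖y → x*[x⁻¹*y]≈y (cover-inv x y x⋖y) (f x))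

    conservation : ∀ v → outflow [ v ] ≈ inflow [ v ]
    conservation v = inv-cancelˡ (cover-inv _ _ (proj₂ (lower-cover [ v ] λ ()))) (begin
      g [ v ] * outflow [ v ]
        ≈⟨ *-congˡ (*-distribʳ-∑ ([ v ] ⋖?_) _ _) ⟨
      g [ v ] * ((∑-above [ v ] λ u v⋖u → inv (above u v⋖u)) * f [ v ])
        ≈⟨ *-assoc _ _ _ ⟨
      g [ v ] * (∑-above [ v ] λ u v⋖u → inv (above u v⋖u)) * f [ v ]
        ≈⟨ relation ⟩
      (∑-below [ v ] λ u _ → f u)
        ≈⟨ g*inflow [ v ] ⟨
      g [ v ] * inflow [ v ] ∎)
      where open Transition (tr v)

    -- Double counting: the weights of all cover relations, grouped by lower end and by upper end.
    total-flow : sum outflow P̂-elements ≈ sum inflow P̂-elements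
    total-flow = begin
      sum outflow P̂-elements
        ≈⟨ sum-cong (λ x → ∑≈sum (x ⋖?_) _) P̂-elements ⟩
      sum (λ x → sum (λ y → select (x ⋖? y) (weight x y)) P̂-elements) P̂-elements
        ≈⟨ sum-swap _ P̂-elements P̂-elements ⟩
      sum (λ y → sum (λ x → select (x ⋖? y) (weight x y)) P̂-elements) P̂-elements
        ≈⟨ sum-cong (λ y → ∑≈sum (_⋖? y) _) P̂-elements ⟨
      sum inflow P̂-elements ∎

    interior : Carrier
    interior = sum inflow (map [_] elements)

    outflow⊥≈inflow⊤ : outflow ⊥± ≈ inflow ⊤±
    -- `P̂-elements` unfolds to 0, 1 and the elements of the poset. Nothing leaves 1 or enters 0,
    -- and by `conservation` the interior contributes equally to both totals, so it can be
    -- subtracted.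
    outflow⊥≈inflow⊤ = ∙-cancelʳ interior _ _ (begin
      outflow ⊥± + interior
        ≈⟨ +-congˡ (begin
             interior                                 ≈⟨ sum-map inflow [_] elements ⟩
             sum (λ v → inflow [ v ]) elements        ≈⟨ sum-cong conservation elements ⟨
             sum (λ v → outflow [ v ]) elements       ≈⟨ sum-map outflow [_] elements ⟨
             sum outflow (map [_] elements)           ≈⟨ +-identityˡ _ ⟨
             0# + sum outflow (map [_] elements)      ≈⟨ +-congʳ (∑-empty (⊤± ⋖?_) _ λ _ → ⊤±-highest) ⟨
             outflow ⊤± + sum outflow (map [_] elements) ∎) ⟩
      sum outflow P̂-elements                          ≈⟨ total-flow ⟩
      sum inflow P̂-elements                           ≈⟨ +-congʳ (∑-empty (_⋖? ⊥±) _ λ _ → ⊥±-lowest) ⟩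
      0# + (inflow ⊤± + interior)                     ≈⟨ +-identityˡ _ ⟩
      inflow ⊤± + interior                            ∎)

proposition14p1 :
    ∀ {c r p ℓ} (𝕂 : Ring c r) (P : FinitePoset p ℓ) →
    let open Ring 𝕂
        open Extended P
        open Rowmotion 𝕂 P
    in
    (L : LinearExtension) →
    let R = rowmotion L in
    (f : Labeling) (Rf≠⊥ : Defined (R f)) →
    let Rf = value (R f) Rf≠⊥
        a  = f ⊥±
        b  = f ⊤±
    in
    (Rf-inv : ∀ u → ⊥± ⋖ u → Invertible (Rf u)) →
    b * (∑-above ⊥± λ u 0⋖u → inv (Rf-inv u 0⋖u)) * a ≈ (∑-below ⊤± λ u _ → f u)
proposition14p1 𝕂 P L f Rf≠⊥ Rf-inv =
  boundary-flow f (value (toggles list f) Rf≠⊥)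
    (λ v → toggles-Transition (linear-Precedes L) Rf≠⊥ (complete v))
    -- The element 1 is never toggled, so rowmotion keeps its label.
    (toggles-away list Rf≠⊥ (All.universal (λ _ ()) list))
    Rf-inv
  where
  open Covers P
  open Proof 𝕂 P
  open Extended.LinearExtension L using (list; complete)
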